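{- The frame property of coreflexivity, $\forall x\forall y(xRy\to x=y)$, is defined by $\circ p$ (where $p$ is a propositional variable): for every frame $\mathcal{F}=\langle S,R\rangle$, $\mathcal{F}\vDash\circ p$ if and only if for all $x,y\in S$, $xRy$ implies $x=y$. Thus coreflexivity is definable in $\mathcal{L}(\circ)$.
   Context: Let $\mathbf{P}$ be a set of propositional variables with $p\in\mathbf{P}$. The language $\mathcal{L}(\circ)$ is given by $\phi::=q\mid\neg\phi\mid(\phi\land\phi)\mid\circ\phi$ with $q\in\mathbf{P}$. A frame is $\mathcal{F}=\langle S,R\rangle$ with $S$ a nonempty set and $R\subseteq S\times S$; a model based on $\mathcal{F}$ is $\mathcal{M}=\langle S,R,V\rangle$ with $V:\mathbf{P}\to\mathcal{P}(S)$. Satisfaction: $\mathcal{M},s\vDash q$ iff $s\in V(q)$; Booleans as usual; $\mathcal{M},s\vDash\circ\phi$ iff ($\mathcal{M},s\vDash\phi$ implies that $\mathcal{M},t\vDash\phi$ for all $t$ with $sRt$). $\mathcal{F}\vDash\phi$ means $\mathcal{M},s\vDash\phi$ for every model $\mathcal{M}$ based on $\mathcal{F}$ and every $s\in S$. A frame property is defined by $\phi$ if a frame $\mathcal{F}$ has the property exactly when $\mathcal{F}\vDash\phi$; it is definable in $\mathcal{L}(\circ)$ if it is defined by some $\mathcal{L}(\circ)$-formula. -}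

module Defs where

open import Level using (Level; _⊔_) renaming (suc to lsuc)
open import Data.Product using (_×_; ∃-syntax)
open import Function.Bundles using (_⇔_)
open import Relation.Binary.Core using (Rel)
open import Relation.Binary.PropositionalEquality using (_≡_)
open import Relation.Nullary using (¬_)
open import Relation.Unary using (Pred; _∈_)

private
  variable
    a ℓ : Level

infix  30 ∘_ ¬′_
infixr 25 _∧′_
infix  4  _,_⊨_ _⊨_

data Formula (P : Set a) : Set a where
  var  : P → Formula P
  ¬′_  : Formula P → Formula P
  _∧′_ : Formula P → Formula P → Formula P
  ∘_   : Formula P → Formula P

record Frame (ℓ : Level) : Set (lsuc ℓ) where
  field
    S        : Set ℓ
    R        : Rel S ℓ
    nonempty : S

-- The models based on a fixed frame; arbitrary (not necessarily decidable)
-- predicates play the role of subsets of S.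
record Model (P : Set a) (F : Frame ℓ) : Set (a ⊔ lsuc ℓ) where
  open Frame F
  field
    V : P → Pred S ℓ

_,_⊨_ : {P : Set a} {F : Frame ℓ} → Model P F → Frame.S F → Formula P → Set ℓ
M , s ⊨ var q    = s ∈ Model.V M q
M , s ⊨ ¬′ φ     = ¬ (M , s ⊨ φ)
M , s ⊨ φ ∧′ ψ   = (M , s ⊨ φ) × (M , s ⊨ ψ)
_,_⊨_ {F = F} M s (∘ φ) = M , s ⊨ φ → ∀ t → Frame.R F s t → M , t ⊨ φ

_⊨_ : {P : Set a} → Frame ℓ → Formula P → Set (a ⊔ lsuc ℓ)
_⊨_ {P = P} F φ = (M : Model P F) (s : Frame.S F) → M , s ⊨ φ

FrameProperty : (ℓ : Level) → Set (lsuc ℓ)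
FrameProperty ℓ = Frame ℓ → Set ℓ

_IsDefinedBy_ : {P : Set a} → FrameProperty ℓ → Formula P → Set (a ⊔ lsuc ℓ)
_IsDefinedBy_ {ℓ = ℓ} X φ = (F : Frame ℓ) → X F ⇔ (F ⊨ φ)

DefinableIn : (P : Set a) → FrameProperty ℓ → Set (a ⊔ lsuc ℓ)
DefinableIn P X = ∃[ φ ] (_IsDefinedBy_ {P = P} X φ)

Coreflexive : FrameProperty ℓ
Coreflexive F = ∀ x y → R x y → x ≡ y
  where open Frame F

{-# OPTIONS --safe #-}
module Submission where

open import Defs
open import Level using (Level)
open import Data.Product using (_×_; _,_)
open import Function.Bundles using (mk⇔)
open import Relation.Binary.PropositionalEquality using (_≡_; refl; subst)

-- Validity of `∘ var p` says that every subset containing a point contains all its successors,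
-- since `p` may denote any subset. If the only possible successor is the point itself, this is
-- automatic; conversely, the smallest subset containing `x`, its singleton, then forces each
-- successor of `x` to equal `x`.

coreflexive-definedBy-∘var : {a ℓ : Level} {P : Set a} (p : P) →
    Coreflexive {ℓ} IsDefinedBy (∘ var p)
coreflexive-definedBy-∘var p F = mk⇔
  (λ coref M s s∈V t sRt → subst (Model.V M p) (coref s t sRt) s∈V)
  -- Evaluate every variable as the singleton {x}.
  (λ valid x y xRy → valid (record { V = λ _ z → x ≡ z }) x refl y xRy)

proposition11 : {a ℓ : Level} (P : Set a) (p : P) →
    (Coreflexive {ℓ} IsDefinedBy (∘ var p)) × DefinableIn P (Coreflexive {ℓ})
proposition11 P p =
  coreflexive-definedBy-∘var p , (∘ var p , coreflexive-definedBy-∘var p)
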